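{- For every integer $r \ge 2$, there exists a string $T$ of length $n = r^2$ over an alphabet of size $r$ that has $n - 2\sqrt{n} + 2$ (distinct) non-empty substrings $U$ satisfying $|U| < |\mathrm{Occ}_T(U)|$.
   Context: A substring of $T$ is a string of the form $T[i]T[i+1]\cdots T[j]$; substrings are counted as distinct strings. For a string $U$ of length $|U|$, $\mathrm{Occ}_T(U)$ is the set of starting positions $i \in \{1,\dots,n-|U|+1\}$ with $T[i]\cdots T[i+|U|-1] = U$. -}

module Defs where

open import Data.Fin as Fin using (Fin)
open import Data.List using (List; []; length; take; drop; filter; upTo; map)
open import Data.List.Membership.Propositional using (_∈_)
open import Data.List.Properties using (≡-dec)
open import Data.List.Relation.Unary.Unique.Propositional using (Unique)
open import Data.Nat using (ℕ; suc; _+_; _∸_; _≤_; _<_)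
open import Data.Product using (_×_; ∃; ∃₂)
open import Function.Bundles using (_⇔_)
open import Level using (Level; _⊔_)
open import Relation.Binary.PropositionalEquality using (_≡_; _≢_)

private variable
  a p : Level
  r : ℕ

Str : ℕ → Set
Str r = List (Fin r)

-- T [ i ⋯ j ] is T[i] T[i+1] ⋯ T[j]; positions are 1-based.  It is the intended
-- factor only when 1 ≤ i ≤ j + 1 and j ≤ length T, and is empty for j = i - 1.
_[_⋯_] : Str r → ℕ → ℕ → Str r
T [ i ⋯ j ] = take (suc j ∸ i) (drop (i ∸ 1) T)

Substring : Str r → Str r → Set
Substring T U =
  ∃₂ λ i j → 1 ≤ i × i ≤ suc j × j ≤ length T × U ≡ T [ i ⋯ j ]

-- The starting positions i ∈ {1, …, n - |U| + 1} with T[i] ⋯ T[i + |U| - 1] = U,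
-- listed in increasing order, hence without repetition.
-- The range is empty when |U| > n.
Occ : Str r → Str r → List ℕ
Occ T U =
  filter (λ i → ≡-dec Fin._≟_ (T [ i ⋯ i + length U ∸ 1 ]) U)
         (map suc (upTo (suc (length T) ∸ length U)))

FrequentSubstring : Str r → Str r → Set
FrequentSubstring T U =
  Substring T U × U ≢ [] × length U < length (Occ T U)

-- Exactly k distinct elements satisfy P.
HasCardinality : {A : Set a} → (A → Set p) → ℕ → Set (a ⊔ p)
HasCardinality {A = A} P k =
  ∃ λ (xs : List A) → Unique xs × (∀ x → x ∈ xs ⇔ P x) × length xs ≡ k

{-# OPTIONS --safe #-}

-- Over the letters 0, …, p with p = r - 1, take T to be the prefix of length
-- m = r² - 2 of (0 1 ⋯ p-1)^∞ followed by p p.  A factor of length l inside the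
-- prefix is determined by l and its start modulo p.  Since m + 1 = p² + 2p, each
-- of the p factors of a given length l ≤ p fits at least p + 1 > l times, while
-- those with l ≥ p + 1 fit at most p + 1 ≤ l times.  A factor that meets the tail
-- ends in one of two places, so it is frequent only if l = 1.  This leaves
-- p² + 1 = n - 2r + 2 frequent substrings.
module Submission where

open import Data.Fin as Fin using (Fin; toℕ; fromℕ; fromℕ<; inject₁)
import Data.Fin.Properties as Fin
open import Data.List
  using (List; []; _∷_; _++_; length; map; take; drop; applyUpTo; upTo;
         allFin; cartesianProductWith)
open import Data.List.Membership.Propositional using (_∈_)
open import Data.List.Membership.Propositional.Properties
open import Data.List.Properties
  using (≡-dec; ∷-injectiveˡ; ∷-injectiveʳ; length-++; length-applyUpTo;
         length-map; length-upTo; length-tabulate)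
open import Data.List.Relation.Binary.Subset.Propositional using (_⊆_)
open import Data.List.Relation.Unary.All as All using ([]; _∷_)
open import Data.List.Relation.Unary.AllPairs using ([]; _∷_)
open import Data.List.Relation.Unary.Any using (here; there)
open import Data.List.Relation.Unary.Unique.Propositional using (Unique)
import Data.List.Relation.Unary.Unique.Propositional.Properties as Unique
open import Data.Nat
open import Data.Nat.DivMod
open import Data.Nat.Properties
open import Data.Nat.Tactic.RingSolver using (solve-∀)
open import Data.Product using (Σ; ∃; _×_; _,_; proj₁; proj₂)
open import Data.Sum using (inj₁; inj₂)
open import Function using (_∘_)
open import Function.Bundles using (mk⇔)
open import Relation.Binary.PropositionalEquality
open import Relation.Unary using (Decidable)
open import Relation.Nullary using (yes; no; contradiction)
open import Defs

-- Lists: a pigeonhole bound and tabulated sequences.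

module _ {a} {A : Set a} where

  -- Pigeonhole: deleting one copy of `x` from `ys` still leaves room for the rest of `xs`, where
  -- `x` does not recur. Occurrence counts are bounded with it from both sides.
  Unique-⊆⇒length≤ : {xs ys : List A} → Unique xs → xs ⊆ ys → length xs ≤ length ys
  Unique-⊆⇒length≤ [] _ = z≤n
  Unique-⊆⇒length≤ {x ∷ xs} (x∉xs ∷ xs!) xs⊆ys
    with us , vs , refl ← ∈-∃++ (xs⊆ys (here refl)) = begin
      suc (length xs)               ≤⟨ s≤s (Unique-⊆⇒length≤ xs! xs⊆us++vs) ⟩
      suc (length (us ++ vs))       ≡⟨ cong suc (length-++ us) ⟩
      suc (length us + length vs)   ≡⟨ +-suc (length us) (length vs) ⟨
      length us + suc (length vs)   ≡⟨ length-++ us ⟨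
      length (us ++ x ∷ vs)         ∎
    where
    open ≤-Reasoning
    xs⊆us++vs : xs ⊆ us ++ vs
    xs⊆us++vs y∈xs with ∈-++⁻ us (xs⊆ys (there y∈xs))
    ... | inj₁ y∈us         = ∈-++⁺ˡ y∈us
    ... | inj₂ (here y≡x)   = contradiction (sym y≡x) (All.lookup x∉xs y∈xs)
    ... | inj₂ (there y∈vs) = ∈-++⁺ʳ us y∈vs

  applyUpTo-cong : {f g : ℕ → A} (n : ℕ) → (∀ {i} → i < n → f i ≡ g i) →
                   applyUpTo f n ≡ applyUpTo g n
  applyUpTo-cong zero    f≗g = refl
  applyUpTo-cong (suc n) f≗g = cong₂ _∷_ (f≗g z<s) (applyUpTo-cong n (f≗g ∘ s<s))

  applyUpTo-injective : {f g : ℕ → A} (n : ℕ) → applyUpTo f n ≡ applyUpTo g n →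
                        ∀ {i} → i < n → f i ≡ g i
  applyUpTo-injective (suc n) eq {zero}  _         = ∷-injectiveˡ eq
  applyUpTo-injective (suc n) eq {suc i} (s<s i<n) =
    applyUpTo-injective n (∷-injectiveʳ eq) i<n

  take-drop-applyUpTo : (f : ℕ → A) (s l n : ℕ) → s + l ≤ n →
    take l (drop s (applyUpTo f n)) ≡ applyUpTo (λ i → f (s + i)) l
  take-drop-applyUpTo f zero    zero    n       _         = refl
  take-drop-applyUpTo f zero    (suc l) (suc n) (s≤s l≤n) =
    cong (f 0 ∷_) (take-drop-applyUpTo (f ∘ suc) 0 l n l≤n)
  take-drop-applyUpTo f (suc s) l       (suc n) (s≤s h)   =
    take-drop-applyUpTo (f ∘ suc) s l n h

  length-cartesianProductWith : ∀ {b c} {B : Set b} {C : Set c} (f : A → B → C) xs ys →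
    length (cartesianProductWith f xs ys) ≡ length xs * length ys
  length-cartesianProductWith f []       ys = refl
  length-cartesianProductWith f (x ∷ xs) ys = trans (length-++ (map (f x) ys))
    (cong₂ _+_ (length-map (f x) ys) (length-cartesianProductWith f xs ys))

%-congˡ-+ : ∀ a b c d .{{_ : NonZero d}} → a % d ≡ b % d → (a + c) % d ≡ (b + c) % d
%-congˡ-+ a b c d eq = begin
  (a + c) % d          ≡⟨ %-distribˡ-+ a c d ⟩
  (a % d + c % d) % d  ≡⟨ cong (λ x → (x + c % d) % d) eq ⟩
  (b % d + c % d) % d  ≡⟨ %-distribˡ-+ b c d ⟨
  (b + c) % d          ∎
  where open ≡-Reasoning

-- Factors and occurrences in a text tabulated from a letter function.

module _ {r : ℕ} (f : ℕ → Fin r) where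

  -- The start `s` is 0-based, so it stands for the 1-based position `suc s`.
  factor : ℕ → ℕ → Str r
  factor s l = applyUpTo (λ i → f (s + i)) l

  length-factor : ∀ s l → length (factor s l) ≡ l
  length-factor s = length-applyUpTo (λ i → f (s + i))

  module _ (n : ℕ) where

    text : Str r
    text = applyUpTo f n

    text[⋯]≡factor : ∀ s l → s + l ≤ n → text [ suc s ⋯ s + l ] ≡ factor s l
    text[⋯]≡factor s l h rewrite m+n∸m≡n s l = take-drop-applyUpTo f s l n h

    factor-Substring : ∀ s l → s + l ≤ n → Substring text (factor s l)
    factor-Substring s l h =
      suc s , s + l , s≤s z≤n , s≤s (m≤m+n s l) ,
      subst (s + l ≤_) (sym (length-applyUpTo f n)) h , sym (text[⋯]≡factor s l h)

    Substring⇒factor : ∀ {U} → Substring text U →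
                       ∃ λ s → ∃ λ l → s + l ≤ n × U ≡ factor s l
    Substring⇒factor (suc s , j , _ , s≤s s≤j , j≤n , refl)
      rewrite length-applyUpTo f n
      with l , refl ← m≤n⇒∃[o]m+o≡n s≤j = s , l , j≤n , text[⋯]≡factor s l j≤n

    range≡ : ∀ t l → suc (length text) ∸ length (factor t l) ≡ suc n ∸ l
    range≡ t l = cong₂ (λ a b → suc a ∸ b) (length-applyUpTo f n) (length-factor t l)

    occurs? : ∀ U → Decidable (λ i → text [ i ⋯ i + length U ∸ 1 ] ≡ U)
    occurs? U i = ≡-dec Fin._≟_ (text [ i ⋯ i + length U ∸ 1 ]) U

    ∈-Occ⁺ : ∀ s t l → s + l ≤ n → (∀ {i} → i < l → f (s + i) ≡ f (t + i)) →
             suc s ∈ Occ text (factor t l)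
    ∈-Occ⁺ s t l h eq = ∈-filter⁺ (occurs? (factor t l))
      (∈-map⁺ suc (∈-upTo⁺ (subst (s <_) (sym (range≡ t l)) (m+n≤o⇒m≤o∸n (suc s) (s≤s h)))))
      (trans (cong (λ x → text [ suc s ⋯ s + x ]) (length-factor t l))
             (trans (text[⋯]≡factor s l h) (applyUpTo-cong l eq)))

    ∈-Occ⁻ : ∀ {x} t l → t + l ≤ n → x ∈ Occ text (factor t l) →
             ∃ λ s → x ≡ suc s × s + l ≤ n × (∀ {i} → i < l → f (s + i) ≡ f (t + i))
    ∈-Occ⁻ t l h x∈
      with x∈range , eq ← ∈-filter⁻ (occurs? (factor t l))
             {xs = map suc (upTo (suc (length text) ∸ length (factor t l)))} x∈
      with s , s∈ , refl ← ∈-map⁻ suc x∈range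
      = s , refl , s+l≤n , applyUpTo-injective l
          (trans (sym (text[⋯]≡factor s l s+l≤n))
                 (trans (cong (λ x → text [ suc s ⋯ s + x ]) (sym (length-factor t l))) eq))
      where
      s+l≤n : s + l ≤ n
      -- As `∸` truncates, moving `l` across requires `l ≤ suc n`, which follows from `h`.
      s+l≤n = s≤s⁻¹ (m≤o∸n⇒m+n≤o (suc s) (≤-trans (m≤n+m l t) (m≤n⇒m≤1+n h))
                (subst (s <_) (range≡ t l) (∈-upTo⁻ s∈)))

    Unique-Occ : ∀ U → Unique (Occ text U)
    Unique-Occ U = Unique.filter⁺ (occurs? U)
      (Unique.map⁺ suc-injective (Unique.upTo⁺ (suc (length text) ∸ length U)))

-- The text: a periodic prefix and a tail of two equal letters.

module Construction (q : ℕ) where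

  -- With r = p + 1 = q + 2, `m` is r² - 2 written without subtraction.
  p m : ℕ
  p = suc q
  m = p * p + (p + q)

  n : ℕ
  n = suc (suc m)

  letter : ℕ → Fin (suc p)
  letter i with i <? m
  ... | yes _ = inject₁ (i mod p)
  ... | no  _ = fromℕ p

  letter-periodic : ∀ {i j} → i < m → j < m → i % p ≡ j % p → letter i ≡ letter j
  letter-periodic {i} {j} i<m j<m eq with i <? m | j <? m
  ... | yes _   | yes _   = cong inject₁ (Fin.toℕ-injective
        (trans (Fin.toℕ-fromℕ< (m%n<n i p)) (trans eq (sym (Fin.toℕ-fromℕ< (m%n<n j p))))))
  ... | no  i≮m | _       = contradiction i<m i≮m
  ... | _       | no  j≮m = contradiction j<m j≮m

  letter-tail : ∀ i j → m ≤ i → m ≤ j → letter i ≡ letter j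
  letter-tail i j m≤i m≤j with i <? m | j <? m
  ... | no  _   | no  _   = refl
  ... | yes i<m | _       = contradiction m≤i (<⇒≱ i<m)
  ... | _       | yes j<m = contradiction m≤j (<⇒≱ j<m)

  -- One position in the prefix forces the other there too, because `fromℕ p` is outside the image
  -- of `inject₁`.
  letter-injective : ∀ i j → j < m → letter i ≡ letter j → i < m × i % p ≡ j % p
  letter-injective i j j<m eq with i <? m | j <? m
  ... | yes i<m | yes _   = i<m ,
        trans (sym (Fin.toℕ-fromℕ< (m%n<n i p)))
          (trans (cong toℕ (Fin.inject₁-injective eq)) (Fin.toℕ-fromℕ< (m%n<n j p)))
  ... | no  _   | yes _   = contradiction eq Fin.fromℕ≢inject₁
  ... | _       | no  j≮m = contradiction j<m j≮m

  T : Str (suc p)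
  T = text letter n

  word : ℕ → ℕ → Str (suc p)
  word = factor letter

  -- Lower bounds on occurrence counts.

  periodicStarts : ℕ → List ℕ
  periodicStarts k = map (λ t → suc (k + t * p)) (upTo (suc p))

  length-periodicStarts : ∀ k → length (periodicStarts k) ≡ suc p
  length-periodicStarts k =
    trans (length-map (λ t → suc (k + t * p)) (upTo (suc p))) (length-upTo (suc p))

  Unique-periodicStarts : ∀ k → Unique (periodicStarts k)
  Unique-periodicStarts k = Unique.map⁺
    (λ {t} {u} eq → *-cancelʳ-≡ t u p (+-cancelˡ-≡ k _ _ (suc-injective eq))) (Unique.upTo⁺ _)

  -- Equality holds at k = q, t = l = p: the prefix is just long enough for every residue to start p
  -- + 1 factors of length p.
  periodicStarts-fit : ∀ k t l → k < p → t ≤ p → l ≤ p → k + t * p + l ≤ m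
  periodicStarts-fit k t l (s≤s k≤q) t≤p l≤p = begin
    k + t * p + l    ≤⟨ +-mono-≤ (+-mono-≤ k≤q (*-monoˡ-≤ p t≤p)) l≤p ⟩
    q + p * p + p    ≡⟨ rearrange q (p * p) p ⟩
    p * p + (p + q)  ∎
    where
    open ≤-Reasoning
    rearrange : ∀ a b c → a + b + c ≡ b + (c + a)
    rearrange = solve-∀

  word-frequent : ∀ {k l} → k < p → l < p → FrequentSubstring T (word k (suc l))
  word-frequent {k} {l} k<p l<p =
    factor-Substring letter n k (suc l) (≤-trans k+l≤m (m≤n+m m 2)) , (λ ()) , (begin-strict
      length (word k (suc l))         ≡⟨ length-factor letter k (suc l) ⟩
      suc l                           <⟨ s≤s l<p ⟩
      suc p                           ≡⟨ length-periodicStarts k ⟨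
      length (periodicStarts k)       ≤⟨ Unique-⊆⇒length≤ (Unique-periodicStarts k) occurs ⟩
      length (Occ T (word k (suc l))) ∎)
    where
    open ≤-Reasoning
    k+l≤m : k + suc l ≤ m
    k+l≤m = subst (λ x → x + suc l ≤ m) (+-identityʳ k)
      (periodicStarts-fit k 0 (suc l) k<p z≤n l<p)
    occurs : periodicStarts k ⊆ Occ T (word k (suc l))
    occurs x∈ with t , t∈ , refl ← ∈-map⁻ (λ t → suc (k + t * p)) {xs = upTo (suc p)} x∈ =
      ∈-Occ⁺ letter n (k + t * p) k (suc l) (≤-trans fits (m≤n+m m 2)) λ {i} i≤l →
        letter-periodic (<-≤-trans (+-monoʳ-< (k + t * p) i≤l) fits)
                        (<-≤-trans (+-monoʳ-< k i≤l) k+l≤m)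
                        (%-congˡ-+ (k + t * p) k i p ([m+kn]%n≡m%n k t p))
      where
      fits : k + t * p + suc l ≤ m
      fits = periodicStarts-fit k t (suc l) k<p (s≤s⁻¹ (∈-upTo⁻ t∈)) l<p

  tail-frequent : FrequentSubstring T (word m 1)
  tail-frequent = factor-Substring letter n m 1 m+1≤n , (λ ()) ,
    -- The goal 1 < length unfolds to 2 ≤ length, witnessed by the two tail positions.
    Unique-⊆⇒length≤ {ys = Occ T (word m 1)} ((<⇒≢ ≤-refl ∷ []) ∷ [] ∷ []) occurs
    where
    m+1≤n : m + 1 ≤ n
    m+1≤n = subst (_≤ n) (+-comm 1 m) (n≤1+n (suc m))
    occurs : suc m ∷ suc (suc m) ∷ [] ⊆ Occ T (word m 1)
    occurs (here refl)         = ∈-Occ⁺ letter n m m 1 m+1≤n (λ _ → refl)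
    occurs (there (here refl)) = ∈-Occ⁺ letter n (suc m) m 1 (≤-reflexive (+-comm (suc m) 1))
      (λ {i} _ → letter-tail (suc m + i) (m + i) (m≤n⇒m≤1+n (m≤m+n m i)) (m≤m+n m i))

  -- Upper bounds on occurrence counts.

  -- The first letter fixes an occurrence's start modulo p, and the last letter keeps its end inside
  -- the prefix. This leaves at most p + 1 starts.
  long-occurrences : ∀ s l → s + suc l ≤ m → p ≤ l →
                     length (Occ T (word s (suc l))) ≤ suc p
  long-occurrences s l h p≤l = subst (length (Occ T (word s (suc l))) ≤_)
    (length-periodicStarts (s % p))
    (Unique-⊆⇒length≤ (Unique-Occ letter n (word s (suc l))) occurs)
    where
    occurs : Occ T (word s (suc l)) ⊆ periodicStarts (s % p)
    occurs x∈ with u , refl , _ , eq ← ∈-Occ⁻ letter n s (suc l) (≤-trans h (m≤n+m m 2)) x∈ =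
      subst (_∈ periodicStarts (s % p))
        (cong suc (trans (cong (_+ u / p * p) (sym u≡s)) (sym (m≡m%n+[m/n]*n u p))))
        (∈-map⁺ (λ t → suc (s % p + t * p)) (∈-upTo⁺ (m<n*o⇒m/o<n u<)))
      where
      u≡s : u % p ≡ s % p
      u≡s = subst₂ (λ a b → a % p ≡ b % p) (+-identityʳ u) (+-identityʳ s)
        (proj₂ (letter-injective (u + 0) (s + 0) (<-≤-trans (+-monoʳ-< s z<s) h) (eq z<s)))
      u+l<m : u + l < m
      u+l<m = proj₁ (letter-injective (u + l) (s + l) (subst (_≤ m) (+-suc s l) h) (eq ≤-refl))
      u< : u < p + p * p
      u< = +-cancelʳ-< q u (p + p * p) (begin-strict
        -- `p≤l` is read as `q < l`.
        u + q            <⟨ +-monoʳ-< u p≤l ⟩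
        u + l            <⟨ u+l<m ⟩
        p * p + (p + q)  ≡⟨ rearrange (p * p) p q ⟩
        p + p * p + q    ∎)
        where
        open ≤-Reasoning
        rearrange : ∀ a b c → a + (b + c) ≡ b + a + c
        rearrange = solve-∀

  -- The last letter is `fromℕ p`, so every occurrence ends at the 0-based position `m` or `suc m`;
  -- its length then determines its start.
  tail-occurrences : ∀ s l → s + suc l ≤ n → m ≤ s + l →
                     length (Occ T (word s (suc l))) ≤ 2
  tail-occurrences s l h m≤s+l =
    Unique-⊆⇒length≤ {ys = suc m ∸ l ∷ suc (suc m) ∸ l ∷ []}
      (Unique-Occ letter n (word s (suc l))) occurs
    where
    occurs : Occ T (word s (suc l)) ⊆ suc m ∸ l ∷ suc (suc m) ∸ l ∷ []
    occurs x∈ with u , refl , u+l<n , eq ← ∈-Occ⁻ letter n s (suc l) h x∈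
      with m ≤? u + l
    ... | no m≰u+l = contradiction
          (proj₁ (letter-injective (s + l) (u + l) (≰⇒> m≰u+l) (sym (eq ≤-refl)))) (≤⇒≯ m≤s+l)
    ... | yes m≤u+l with m≤n⇒m<n∨m≡n m≤u+l
    ...   | inj₂ m≡u+l = here (trans (sym (m+n∸n≡m (suc u) l)) (cong (λ x → suc x ∸ l) (sym m≡u+l)))
    ...   | inj₁ m<u+l = there (here (trans (sym (m+n∸n≡m (suc u) l))
            (cong (λ x → suc x ∸ l)
              (≤-antisym (s≤s⁻¹ (subst (_≤ n) (+-suc u l) u+l<n)) m<u+l))))

  -- The complete list of frequent substrings.

  -- The second index is the length minus one, so the lengths are 1 to p.
  shortWord : Fin p → Fin p → Str (suc p)
  shortWord k l = word (toℕ k) (suc (toℕ l))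

  frequent : List (Str (suc p))
  frequent = word m 1 ∷ cartesianProductWith shortWord (allFin p) (allFin p)

  ∈-frequent⇒FrequentSubstring : ∀ {U} → U ∈ frequent → FrequentSubstring T U
  ∈-frequent⇒FrequentSubstring (here refl) = tail-frequent
  ∈-frequent⇒FrequentSubstring (there U∈)
    with k , l , _ , _ , refl ← ∈-cartesianProductWith⁻ shortWord (allFin p) (allFin p) U∈
    = word-frequent (Fin.toℕ<n k) (Fin.toℕ<n l)

  -- By periodicity the start may be replaced by its residue `s % p`, which only moves the factor to
  -- the left.
  short-∈-frequent : ∀ s l → s + suc l ≤ m → l < p → word s (suc l) ∈ frequent
  short-∈-frequent s l h l<p = there (subst (_∈ cartesianProductWith shortWord (allFin p) (allFin p))
    (trans (cong₂ (λ a b → word a (suc b)) (Fin.toℕ-fromℕ< (m%n<n s p)) (Fin.toℕ-fromℕ< l<p))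
           (applyUpTo-cong (suc l) λ {i} i≤l →
             letter-periodic (≤-<-trans (+-monoˡ-≤ i (m%n≤m s p)) (inside i≤l)) (inside i≤l)
                             (%-congˡ-+ (s % p) s i p (m%n%n≡m%n s p))))
    (∈-cartesianProductWith⁺ shortWord (∈-allFin (s mod p)) (∈-allFin (fromℕ< l<p))))
    where
    inside : ∀ {i} → i < suc l → s + i < m
    inside i≤l = <-≤-trans (+-monoʳ-< s i≤l) h

  word-∈-frequent : ∀ s l → s + suc l ≤ n →
                    suc l < length (Occ T (word s (suc l))) → word s (suc l) ∈ frequent
  word-∈-frequent s l h l<Occ with s + suc l ≤? m | l <? p
  ... | yes h′ | yes l<p = short-∈-frequent s l h′ l<p
  ... | yes h′ | no  l≮p = contradiction
        (s≤s⁻¹ (≤-trans l<Occ (long-occurrences s l h′ (≮⇒≥ l≮p)))) l≮p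
  ... | no  h′ | _
    with m≤s+l ← s≤s⁻¹ (subst (m <_) (+-suc s l) (≰⇒> h′))
    -- From suc l < count ≤ 2 follows l = 0, so the word is the single tail letter.
    with s≤s (s≤s z≤n) ← ≤-trans l<Occ (tail-occurrences s l h m≤s+l)
    = here (cong (_∷ []) (letter-tail (s + 0) (m + 0) m≤s+l (m≤m+n m 0)))

  FrequentSubstring⇒∈-frequent : ∀ {U} → FrequentSubstring T U → U ∈ frequent
  FrequentSubstring⇒∈-frequent (sub , U≢[] , U<Occ) with Substring⇒factor letter n sub
  ... | s , zero  , h , refl = contradiction refl U≢[]
  ... | s , suc l , h , refl = word-∈-frequent s l h
        (subst (_< length (Occ T (word s (suc l)))) (length-factor letter s (suc l)) U<Occ)

  -- The first letter separates the tail word from the short words and recovers `k` among the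
  -- latter; the length recovers the second index.
  Unique-frequent : Unique frequent
  Unique-frequent = All.tabulate apart ∷
    Unique.cartesianProductWith⁺ shortWord injective (Unique.allFin⁺ p) (Unique.allFin⁺ p)
    where
    k+0<m : ∀ (k : Fin p) → toℕ k + 0 < m
    k+0<m k = subst (_< m) (sym (+-identityʳ (toℕ k)))
      (<-≤-trans (Fin.toℕ<n k) (≤-trans (m≤m+n p q) (m≤n+m (p + q) (p * p))))
    apart : ∀ {U} → U ∈ cartesianProductWith shortWord (allFin p) (allFin p) → word m 1 ≢ U
    apart U∈ eq
      with k , l , _ , _ , refl ← ∈-cartesianProductWith⁻ shortWord (allFin p) (allFin p) U∈
      = <⇒≱ (proj₁ (letter-injective (m + 0) (toℕ k + 0) (k+0<m k) (∷-injectiveˡ eq))) (m≤m+n m 0)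
    injective : ∀ {k l i j} → shortWord k i ≡ shortWord l j → k ≡ l × i ≡ j
    injective {k} {l} {i} {j} eq =
      Fin.toℕ-injective (begin
        toℕ k            ≡⟨ m<n⇒m%n≡m (Fin.toℕ<n k) ⟨
        toℕ k % p        ≡⟨ cong (_% p) (+-identityʳ (toℕ k)) ⟨
        (toℕ k + 0) % p  ≡⟨ proj₂ (letter-injective (toℕ k + 0) (toℕ l + 0) (k+0<m l)
                                    (∷-injectiveˡ eq)) ⟩
        (toℕ l + 0) % p  ≡⟨ cong (_% p) (+-identityʳ (toℕ l)) ⟩
        toℕ l % p        ≡⟨ m<n⇒m%n≡m (Fin.toℕ<n l) ⟩
        toℕ l            ∎) ,
      Fin.toℕ-injective (suc-injective (begin
        suc (toℕ i)             ≡⟨ length-factor letter (toℕ k) (suc (toℕ i)) ⟨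
        length (shortWord k i)  ≡⟨ cong length eq ⟩
        length (shortWord l j)  ≡⟨ length-factor letter (toℕ l) (suc (toℕ j)) ⟩
        suc (toℕ j)             ∎))
      where open ≡-Reasoning

  length-frequent : length frequent ≡ suc (p * p)
  length-frequent = cong suc (trans (length-cartesianProductWith shortWord (allFin p) (allFin p))
    (cong₂ _*_ (length-tabulate {n = p} (λ i → i)) (length-tabulate {n = p} (λ i → i))))

proposition2p2 : (r : ℕ) → 2 ≤ r →
    let n = r ^ 2 in
    Σ (Str r) λ T →
    length T ≡ n × HasCardinality (FrequentSubstring T) (n ∸ 2 * r + 2)
proposition2p2 (suc (suc q)) (s≤s (s≤s z≤n)) =
  T , trans (length-applyUpTo letter n) (n≡r² q) ,
  frequent , Unique-frequent ,
  (λ _ → mk⇔ ∈-frequent⇒FrequentSubstring FrequentSubstring⇒∈-frequent) ,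
  trans length-frequent (sym (count≡ q))
  where
  open Construction q
  n≡r² : ∀ q → 2 + ((1 + q) * (1 + q) + (1 + q + q)) ≡ (2 + q) * ((2 + q) * 1)
  n≡r² = solve-∀
  -- Exhibits 2r as a summand of r², so the truncated subtraction in the count is exact and leaves
  -- q(q + 2) = p² - 1.
  r²≡ : ∀ q → (2 + q) * ((2 + q) * 1) ≡ q * (2 + q) + 2 * (2 + q)
  r²≡ = solve-∀
  p²≡ : ∀ q → q * (2 + q) + 2 ≡ 1 + (1 + q) * (1 + q)
  p²≡ = solve-∀
  count≡ : ∀ q → (2 + q) ^ 2 ∸ 2 * (2 + q) + 2 ≡ suc (suc q * suc q)
  count≡ q = trans (cong (λ x → x ∸ 2 * (2 + q) + 2) (r²≡ q))
    (trans (cong (_+ 2) (m+n∸n≡m (q * (2 + q)) (2 * (2 + q)))) (p²≡ q))
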